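{- The derivation of the expansion tableau is valid; that is: if $\mathbf{T}=(G,\mathcal{G},\mathcal{M},\mathcal{X},\simeq)$ is a valid matroid tableau, then its expansion tableau $[\mathbf{T}]_\simeq$ is a valid matroid tableau.
   Context: Matroids have finite ground sets. A digraph is a pair $D=(V,A)$ with $V$ finite and $A\subseteq V\times V$. A path in $D$ is a non-empty, non-repeating sequence of vertices $p_1p_2\ldots p_n$ with $(p_i,p_{i+1})\in A$ for $1\le i<n$. A routing from $X$ to $Y$ in $D$ is a family $R$ of paths in $D$ such that every $x\in X$ is the first vertex of some $p\in R$, every $p\in R$ ends in a vertex of $Y$, and any two distinct paths of $R$ are vertex-disjoint. For $E,T\subseteq V$, $\Gamma(D,T,E)$ is the matroid on $E$ whose independent sets are those $X\subseteq E$ for which there is a routing from $X$ to $T$ in $D$. A matroid $(E,\mathcal{I})$ is a gammoid if it equals $\Gamma(D,T,E)$ for some digraph $D=(V,A)$ with $E\subseteq V$ and some $T\subseteq V$; it is a strict gammoid if such a representation exists with $V=E$. A matroid tableau is a tuple $\mathbf{T}=(G,\mathcal{G},\mathcal{M},\mathcal{X},\simeq)$ where $G$ is a matroid (the goal), $\mathcal{G},\mathcal{M},\mathcal{X}$ are families of matroids, and $\simeq$ is an equivalence relation on $\{G'\mid G'\text{ is a minor of }G\}\cup\mathcal{G}\cup\mathcal{M}\cup\mathcal{X}$. The equivalence class of $M$ is denoted $[M]_\simeq$. $\mathbf{T}$ is valid if (i) all matroids in $\mathcal{G}$ are gammoids, (ii) no matroid in $\mathcal{M}$ is a strict gammoid,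 (iii) no matroid in $\mathcal{X}$ is a gammoid, and (iv) every equivalence class of $\simeq$ either consists only of gammoids or contains no gammoid. The expansion tableau of $\mathbf{T}$ is $[\mathbf{T}]_\simeq=(G,\mathcal{G}',\mathcal{M},\mathcal{X}',\simeq)$ with $\mathcal{G}'=\bigcup_{M\in\mathcal{G}}[M]_\simeq$ and $\mathcal{X}'=\bigcup_{M\in\mathcal{X}}[M]_\simeq$. -}

module Defs where

open import Level using (Level; suc; _⊔_)
open import Data.List.Base using (List; []; _∷_; _++_; length)
open import Data.List.Membership.Propositional using (_∈_; _∉_)
open import Data.List.NonEmpty.Base using (List⁺; head; last; toList)
open import Data.List.Relation.Binary.Disjoint.Propositional using (Disjoint)
open import Data.List.Relation.Binary.Subset.Propositional using (_⊆_)
open import Data.List.Relation.Unary.Linked using (Linked)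
open import Data.List.Relation.Unary.Unique.Propositional using (Unique)
open import Data.Nat.Base using (_<_)
open import Data.Product.Base using (_×_; _,_; ∃-syntax; Σ-syntax)
open import Data.Sum.Base using (_⊎_)
open import Function.Bundles using (_⇔_)
open import Relation.Binary.Core using (Rel)
open import Relation.Binary.Definitions using (Symmetric; Transitive; _Respects_)
open import Relation.Binary.PropositionalEquality.Core using (_≡_; _≢_)
open import Relation.Nullary.Negation.Core using (¬_)
open import Relation.Unary using (Pred; _∪_)

private
  variable
    u a : Level
    U : Set u

-- Elements of ground sets and vertices of digraphs are drawn from a common
-- type U.  A finite subset of U is a list, of which only the membership
-- predicate matters: order and multiplicity are irrelevant.
-- Whether a matroid is a gammoid may depend on having vertices outside its
-- ground set, so the definitions have their usual meaning when U is infinite.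

infix 4 _≐_

_≐_ : Rel (List U) _
X ≐ Y = (X ⊆ Y) × (Y ⊆ X)

record SetSystem (U : Set u) : Set (suc u) where
  field
    ground : List U
    Indep  : Pred (List U) u

-- Equality of pairs (E, 𝓘): lists stand for sets, so ground sets are compared
-- up to ≐ and families of independent sets extensionally.

infix 4 _≈_

_≈_ : Rel (SetSystem U) _
S ≈ S′ = (ground S ≐ ground S′) × (∀ X → Indep S X ⇔ Indep S′ X)
  where open SetSystem

-- indep-⊆ also makes Indep invariant under ≐.  In exchange the lists are
-- duplicate-free, so that length is cardinality.

record IsMatroid {U : Set u} (S : SetSystem U) : Set u where
  open SetSystem S
  field
    indep-ground : ∀ {X} → Indep X → X ⊆ ground
    indep-∅      : Indep []
    indep-⊆      : ∀ {X Y} → X ⊆ Y → Indep Y → Indep X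
    exchange     : ∀ {X Y} → Unique X → Unique Y → Indep X → Indep Y →
                   length X < length Y →
                   ∃[ y ] y ∈ Y × y ∉ X × Indep (y ∷ X)

record Matroid (U : Set u) : Set (suc u) where
  field
    system    : SetSystem U
    isMatroid : IsMatroid system
  open SetSystem system public
  open IsMatroid isMatroid public

open Matroid using (system; ground; Indep)

infix 4 _≈ᴹ_

_≈ᴹ_ : Rel (Matroid U) _
M ≈ᴹ N = system M ≈ system N

record IsBasisOf (M : Matroid {u} U) (C B : List U) : Set u where
  field
    subset  : B ⊆ C
    indep   : Indep M B
    maximal : ∀ {x} → x ∈ C → Indep M (x ∷ B) → x ∈ B

-- M / C ∣ F is the contraction of C followed by the restriction to F, for
-- disjoint C, F ⊆ E; equivalently, C is contracted and E ∖ (C ∪ F) deleted.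

_/_∣_ : Matroid U → List U → List U → SetSystem U
M / C ∣ F = record
  { ground = F
  ; Indep  = λ X → X ⊆ F × (∃[ B ] IsBasisOf M C B × Indep M (B ++ X))
  }

IsMinorOf : Matroid U → Matroid U → Set _
IsMinorOf {U = U} N M =
  Σ[ C ∈ List U ] Σ[ F ∈ List U ]
    C ⊆ ground M × F ⊆ ground M × Disjoint C F × system N ≈ (M / C ∣ F)

record Digraph (U : Set u) : Set u where
  field
    vertices : List U
    arcs     : List (U × U)
    arcs⊆    : ∀ {x y} → (x , y) ∈ arcs → x ∈ vertices × y ∈ vertices

open Digraph using (vertices; arcs)

record IsPath {U : Set u} (D : Digraph U) (p : List⁺ U) : Set u where
  field
    in-vertices   : toList p ⊆ vertices D
    non-repeating : Unique (toList p)
    linked        : Linked (λ x y → (x , y) ∈ arcs D) (toList p)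

record IsRouting {U : Set u} (D : Digraph U) (X Y : List U)
                 (R : List (List⁺ U)) : Set u where
  field
    paths    : ∀ {p} → p ∈ R → IsPath D p
    starts   : ∀ {x} → x ∈ X → ∃[ p ] p ∈ R × head p ≡ x
    ends     : ∀ {p} → p ∈ R → last p ∈ Y
    disjoint : ∀ {p q} → p ∈ R → q ∈ R → p ≢ q →
               Disjoint (toList p) (toList q)

Γ : Digraph U → List U → List U → SetSystem U
Γ D T E = record
  { ground = E
  ; Indep  = λ X → X ⊆ E × (∃[ R ] IsRouting D X T R)
  }

IsGammoid : Matroid U → Set _
IsGammoid {U = U} M =
  Σ[ D ∈ Digraph U ] Σ[ T ∈ List U ] Σ[ E ∈ List U ]
    T ⊆ vertices D × E ⊆ vertices D × system M ≈ Γ D T E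

IsStrictGammoid : Matroid U → Set _
IsStrictGammoid {U = U} M =
  Σ[ D ∈ Digraph U ] Σ[ T ∈ List U ] Σ[ E ∈ List U ]
    T ⊆ vertices D × E ≐ vertices D × system M ≈ Γ D T E

-- The bare tuple (G, 𝒢, ℳ, 𝒳, ≃).  The level suc u accommodates the unions
-- over families of matroids in the expansion.

record RawTableau (U : Set u) : Set (suc (suc u)) where
  infix 4 _≃_
  field
    goal  : Matroid U
    𝒢 ℳ 𝒳 : Pred (Matroid U) (suc u)
    _≃_   : Rel (Matroid U) (suc u)

  Domain : Pred (Matroid U) (suc u)
  Domain = (λ N → IsMinorOf N goal) ∪ 𝒢 ∪ ℳ ∪ 𝒳

  [_] : Matroid U → Pred (Matroid U) (suc u)
  [ M ] N = M ≃ N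

-- ≃ is an equivalence relation on the subset S: it is contained in S × S, and
-- it is reflexive with respect to equality of matroids, which is ≈ᴹ.

record IsEquivalenceOn {U : Set u} (S : Pred (Matroid U) a)
                       (_≃_ : Rel (Matroid U) a) : Set (suc u ⊔ a) where
  field
    domain : ∀ {M N} → M ≃ N → S M × S N
    refl   : ∀ {M N} → S M → M ≈ᴹ N → M ≃ N
    sym    : Symmetric _≃_
    trans  : Transitive _≃_

-- Families of matroids are sets with respect to the equality ≈ᴹ.

record IsTableau {U : Set u} (𝐓 : RawTableau U) : Set (suc u) where
  open RawTableau 𝐓
  field
    𝒢-resp : 𝒢 Respects _≈ᴹ_
    ℳ-resp : ℳ Respects _≈ᴹ_
    𝒳-resp : 𝒳 Respects _≈ᴹ_
    equiv  : IsEquivalenceOn Domain _≃_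

record IsValid {U : Set u} (𝐓 : RawTableau U) : Set (suc u) where
  open RawTableau 𝐓
  field
    𝒢-gammoids     : ∀ {M} → 𝒢 M → IsGammoid M
    ℳ-non-strict   : ∀ {M} → ℳ M → ¬ IsStrictGammoid M
    𝒳-non-gammoids : ∀ {M} → 𝒳 M → ¬ IsGammoid M
    classes        : ∀ {M} → Domain M →
                     (∀ {N} → [ M ] N → IsGammoid N) ⊎
                     (∀ {N} → [ M ] N → ¬ IsGammoid N)

expansion : RawTableau U → RawTableau U
expansion 𝐓 = record
  { goal = goal
  ; 𝒢    = λ N → ∃[ M ] 𝒢 M × [ M ] N
  ; ℳ    = ℳ
  ; 𝒳    = λ N → ∃[ M ] 𝒳 M × [ M ] N
  ; _≃_  = _≃_
  }
  where open RawTableau 𝐓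

{-# OPTIONS --safe #-}
module Submission where

open import Defs
open import Data.Empty using (⊥-elim)
open import Data.Nat.Base using (ℕ)
open import Data.Product.Base as Product using (_×_; _,_; proj₁; proj₂; ∃-syntax)
open import Data.Sum.Base using (inj₁; inj₂)
open import Function.Base using (id)
open import Function.Bundles using (_↣_)
open import Function.Construct.Identity using (⇔-id)
open import Relation.Binary.Core using (Rel)
open import Relation.Binary.Definitions using (Reflexive; _Respects_)
open import Relation.Nullary.Negation.Core using (¬_)
open import Relation.Unary using (Pred; _⊆_)

-- Every matroid added to `𝒢` or `𝒳` lies in the class of an old member. That member belongs to its
-- own class, so by the dichotomy for classes its status, gammoid or not, is shared by the whole
-- class. The relation `≃` does not change, and neither, up to extensional equality, does its
-- domain: reflexivity keeps the old members, and anything related by `≃` was in `Domain` already.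
-- Hence the equivalence axioms and the dichotomy carry over.

≈ᴹ-refl : ∀ {u} {U : Set u} → Reflexive (_≈ᴹ_ {U = U})
≈ᴹ-refl {x = M} = (id , id) , λ X → ⇔-id (Matroid.Indep M X)

module _ {u a} {U : Set u} {S : Pred (Matroid U) a} {_≃_ : Rel (Matroid U) a}
         (equiv : IsEquivalenceOn S _≃_) where
  open IsEquivalenceOn equiv

  ≃-refl : ∀ {M} → S M → M ≃ M
  ≃-refl {M} s = refl s (≈ᴹ-refl {x = M})

  -- Equal matroids in the domain are `≃`-related, because `refl` is taken relative to `≈ᴹ`;
  -- transitivity then absorbs the replacement.
  saturation-resp : ∀ {p} (P : Pred (Matroid U) p) →
                    (λ N → ∃[ M ] P M × M ≃ N) Respects _≈ᴹ_
  saturation-resp P N≈N′ (M , m , M≃N) =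
    M , m , trans M≃N (refl (proj₂ (domain M≃N)) N≈N′)

  IsEquivalenceOn-≐ : ∀ {S′ : Pred (Matroid U) a} → S ⊆ S′ → S′ ⊆ S →
                      IsEquivalenceOn S′ _≃_
  IsEquivalenceOn-≐ S⊆S′ S′⊆S = record
    { domain = λ M≃N → Product.map S⊆S′ S⊆S′ (domain M≃N)
    ; refl   = λ s → refl (S′⊆S s)
    ; sym    = sym
    ; trans  = trans
    }

module _ {u} {U : Set u} (𝐓 : RawTableau U) (tableau : IsTableau 𝐓) where
  open RawTableau 𝐓
  open RawTableau (expansion 𝐓) using ()
    renaming (Domain to Domain′)
  open IsTableau tableau
  open IsEquivalenceOn equiv using (domain)

  -- By reflexivity, a member of `𝒢` or `𝒳` witnesses its own membership in the enlarged family.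
  Domain⊆expansion : Domain ⊆ Domain′
  Domain⊆expansion (inj₁ m) = inj₁ m
  Domain⊆expansion s@(inj₂ (inj₁ g)) = inj₂ (inj₁ (_ , g , ≃-refl equiv s))
  Domain⊆expansion (inj₂ (inj₂ (inj₁ m))) = inj₂ (inj₂ (inj₁ m))
  Domain⊆expansion s@(inj₂ (inj₂ (inj₂ x))) =
    inj₂ (inj₂ (inj₂ (_ , x , ≃-refl equiv s)))

  -- An added matroid is the right-hand side of some `M ≃ N`, and `≃` relates only elements of
  -- `Domain`.
  expansion⊆Domain : Domain′ ⊆ Domain
  expansion⊆Domain (inj₁ m) = inj₁ m
  expansion⊆Domain (inj₂ (inj₁ (_ , _ , M≃N))) = proj₂ (domain M≃N)
  expansion⊆Domain (inj₂ (inj₂ (inj₁ m))) = inj₂ (inj₂ (inj₁ m))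
  expansion⊆Domain (inj₂ (inj₂ (inj₂ (_ , _ , M≃N)))) = proj₂ (domain M≃N)

  expansion-isTableau : IsTableau (expansion 𝐓)
  expansion-isTableau = record
    { 𝒢-resp = saturation-resp equiv 𝒢
    ; ℳ-resp = ℳ-resp
    ; 𝒳-resp = saturation-resp equiv 𝒳
    ; equiv  = IsEquivalenceOn-≐ equiv Domain⊆expansion expansion⊆Domain
    }

  expansion-isValid : IsValid 𝐓 → IsValid (expansion 𝐓)
  expansion-isValid valid = record
    { 𝒢-gammoids     = 𝒢′-gammoids
    ; ℳ-non-strict   = ℳ-non-strict
    ; 𝒳-non-gammoids = 𝒳′-non-gammoids
    ; classes        = λ s → classes (expansion⊆Domain s)
    }
    where
    open IsValid valid

    𝒢′-gammoids : ∀ {N} → ∃[ M ] 𝒢 M × M ≃ N → IsGammoid N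
    𝒢′-gammoids (M , g , M≃N) with classes (proj₁ (domain M≃N))
    ... | inj₁ all  = all M≃N
    -- Impossible: the class of `M` contains `M`, a gammoid.
    ... | inj₂ none = ⊥-elim (none (≃-refl equiv (proj₁ (domain M≃N))) (𝒢-gammoids g))

    𝒳′-non-gammoids : ∀ {N} → ∃[ M ] 𝒳 M × M ≃ N → ¬ IsGammoid N
    𝒳′-non-gammoids (M , x , M≃N) with classes (proj₁ (domain M≃N))
    -- Impossible: `M` would be a gammoid as a member of its own class.
    ... | inj₁ all  = ⊥-elim (𝒳-non-gammoids x (all (≃-refl equiv (proj₁ (domain M≃N)))))
    ... | inj₂ none = none M≃N

lemma3p6 : ∀ {u} {U : Set u} → ℕ ↣ U → (𝐓 : RawTableau U) →
    IsTableau 𝐓 → IsValid 𝐓 →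
    IsTableau (expansion 𝐓) × IsValid (expansion 𝐓)
lemma3p6 _ 𝐓 tableau valid =
  expansion-isTableau 𝐓 tableau , expansion-isValid 𝐓 tableau valid
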